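{- Let $X=x_1x_2\cdots x_n$ and $Y=y_1y_2\cdots y_m$ be two input sequences of lengths $n$ and $m$, respectively, and let $P=p_1p_2\cdots p_r$ be a constraint string of length $r$. Let $Z(i,j,k)$ denote the set of all LCSs of $X[1:i]$ and $Y[1:j]$ excluding $P$ as a substring and with $\sigma(z)=k$ for each $z\in Z(i,j,k)$ (that is, the longest strings among the common subsequences $z$ of $X[1:i]$ and $Y[1:j]$ that do not contain $P$ as a substring and satisfy $\sigma(z)=k$). The length of an LCS in $Z(i,j,k)$ is denoted by $f(i,j,k)$. Then, for any $1\le i\le n$, $1\le j\le m$ and $0\le k<r$, $f(i,j,k)$ can be computed by the recursive formula $$ f(i,j,k)=\begin{cases} \max\{ f(i-1,j,k),\ f(i,j-1,k)\} & \text{if } x_i\neq y_j,\\[4pt] \max\Big\{ f(i-1,j-1,k),\ 1+\max\limits_{0\le t<r}\{ f(i-1,j-1,t) \mid \sigma(P[1:t]\oplus x_i)=k\}\Big\} & \text{if } x_i=y_j. \end{cases} $$ The boundary conditions of this recursive formula are $f(i,0,k)=f(0,j,k)=0$ for any $0\le i\le n$, $0\le j\le m$ and $0\le k\le r$.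
   Context: All sequences are strings of characters over an alphabet $\Sigma$. For a string $S=s_1\cdots s_l$, $S[1:i]=s_1\cdots s_i$ is its prefix of length $i$ (empty if $i=0$). A subsequence of $S$ is obtained by deleting zero or more (not necessarily contiguous) characters from $S$; a substring is a subsequence of successive characters of $S$. A common subsequence of two strings is a string that is a subsequence of both; LCS abbreviates longest common subsequence. The symbol $\oplus$ denotes string concatenation (a character is regarded as a string of length 1). For the fixed constraint string $P$ and any string $S$, $\sigma(S)$ denotes the length of the longest suffix of $S$ that is also a prefix of $P$.
   Formalization: Where Z(i,j,k) is empty, f is undefined in the text and is taken as -∞ (also the max over no t); f(i,0,k)=f(0,j,k)=0 is claimed only for nonempty Z, and the table computed from the stated zero boundary values is shown to equal f(i,j,k) wherever Z(i,j,k) is nonempty. -}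

module Defs where

open import Data.Empty using (⊥-elim)
open import Data.Fin.Base using (Fin; toℕ)
open import Data.List.Base
  using (List; []; _∷_; _∷ʳ_; _++_; length; lookup; map; filter; foldr; take; upTo)
  renaming (tails to suffixes)
open import Data.List.Extrema.Nat using (max)
open import Data.List.Membership.Propositional using (_∈_)
open import Data.List.Membership.Propositional.Properties
  using (∈-map⁺; ∈-++⁺ˡ; ∈-++⁺ʳ; ∈-filter⁺; ∈-filter⁻)
open import Data.List.Relation.Binary.Infix.Heterogeneous using (Infix)
open import Data.List.Relation.Binary.Infix.Heterogeneous.Properties using (infix?)
open import Data.List.Relation.Binary.Prefix.Heterogeneous using (Prefix)
open import Data.List.Relation.Binary.Prefix.Heterogeneous.Properties using (prefix?)
open import Data.List.Relation.Binary.Sublist.Propositional as Sublist using (_⊆_; []; _∷_)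
import Data.List.Relation.Binary.Sublist.DecPropositional as DecSublist
open import Data.List.Relation.Unary.Any using (here; there)
open import Data.Nat.Base using (ℕ; zero; suc; _⊔_; _≤_; _<_)
import Data.Nat.Properties as ℕ
open import Data.Product.Base using (∃; _×_; _,_; proj₁; proj₂)
open import Data.Sum.Base using (inj₁; inj₂)
open import Function.Base using (_∘_)
open import Relation.Binary.Definitions using (DecidableEquality)
open import Relation.Binary.PropositionalEquality using (_≡_; _≢_; refl; sym; cong)
open import Relation.Nullary using (¬_; Dec; ¬?; _×-dec_)
open import Relation.Nullary.Decidable using (map′)
open import Relation.Nullary.Construct.Add.Infimum using (_₋; ⊥₋; [_])

-- Lengths live in ℕ ₋ = ℕ ∪ {-∞}; ⊥₋ = -∞ is the maximum of the empty set.

infixl 6 _⊔₋_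

_⊔₋_ : ℕ ₋ → ℕ ₋ → ℕ ₋
⊥₋    ⊔₋ y     = y
[ x ] ⊔₋ ⊥₋    = [ x ]
[ x ] ⊔₋ [ y ] = [ x ⊔ y ]

1+₋_ : ℕ ₋ → ℕ ₋
1+₋ ⊥₋    = ⊥₋
1+₋ [ x ] = [ suc x ]

max₋ : List (ℕ ₋) → ℕ ₋
max₋ = foldr _⊔₋_ ⊥₋

subsequences : ∀ {a} {A : Set a} → List A → List (List A)
subsequences []       = [] ∷ []
subsequences (x ∷ xs) = map (x ∷_) (subsequences xs) ++ subsequences xs

module ConstrainedLCS {a} {A : Set a} (_≟_ : DecidableEquality A) (X Y P : List A) where

  n m r : ℕ
  n = length X
  m = length Y
  r = length P

  σ : List A → ℕ
  σ S = max 0 (map length (filter (λ u → prefix? _≟_ u P) (suffixes S)))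

  record Candidate (i j k : ℕ) (z : List A) : Set a where
    constructor candidate
    field
      ⊆X       : z ⊆ take i X
      ⊆Y       : z ⊆ take j Y
      excludes : ¬ Infix _≡_ P z
      state    : σ z ≡ k

  Z : ℕ → ℕ → ℕ → List A → Set a
  Z i j k z = Candidate i j k z × (∀ w → Candidate i j k w → length w ≤ length z)

  candidate? : ∀ i j k z → Dec (Candidate i j k z)
  candidate? i j k z = map′ (λ (p , q , e , s) → candidate p q e s)
                            (λ (candidate p q e s) → p , q , e , s)
    (z ⊆? take i X ×-dec z ⊆? take j Y ×-dec ¬? (infix? _≟_ P z) ×-dec σ z ℕ.≟ k)
    where open DecSublist _≟_ using (_⊆?_)

  -- The common length of the members of Z i j k, or ⊥₋ if there are none:
  -- see f-Z and f-∅ below.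
  f : ℕ → ℕ → ℕ → ℕ ₋
  f i j k = max₋ (map ([_] ∘ length) (filter (candidate? i j k) (subsequences (take i X))))

  -- Fin indices are zero-based: i stands for the 1-based position suc (toℕ i),
  -- so lookup X i is the last character of take (suc (toℕ i)) X.
  Recurrence : (ℕ → ℕ → ℕ → ℕ ₋) → Set a
  Recurrence F = ∀ (i : Fin n) (j : Fin m) (k : ℕ) → k < r →
    let i-1 = toℕ i ; j-1 = toℕ j ; xᵢ = lookup X i ; yⱼ = lookup Y j in
    (xᵢ ≢ yⱼ →
      F (suc i-1) (suc j-1) k ≡ F i-1 (suc j-1) k ⊔₋ F (suc i-1) j-1 k)
    ×
    (xᵢ ≡ yⱼ →
      F (suc i-1) (suc j-1) k ≡
        F i-1 j-1 k
        ⊔₋ 1+₋ max₋ (map (F i-1 j-1)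
                         (filter (λ t → σ (take t P ∷ʳ xᵢ) ℕ.≟ k) (upTo r))))

  -- The value 0 is prescribed also for k > 0, where Z i 0 k and Z 0 j k are
  -- empty.  So f itself does not satisfy Boundary in general, but the table F
  -- computed from these initial values is meant to agree with f wherever Z i j k
  -- is inhabited.
  Boundary : (ℕ → ℕ → ℕ → ℕ ₋) → Set
  Boundary F = (∀ i k → i ≤ n → k ≤ r → F i 0 k ≡ [ 0 ])
             × (∀ j k → j ≤ m → k ≤ r → F 0 j k ≡ [ 0 ])

  private
    ∈-subsequences : ∀ {z xs : List A} → z ⊆ xs → z ∈ subsequences xs
    ∈-subsequences []         = here refl
    ∈-subsequences {xs = x ∷ xs} (.x Sublist.∷ʳ p) =
      ∈-++⁺ʳ (map (x ∷_) (subsequences xs)) (∈-subsequences p)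
    ∈-subsequences (refl ∷ p) = ∈-++⁺ˡ (∈-map⁺ _ (∈-subsequences p))

    -- ℓ is the greatest length of a member of zs.
    IsMax : List (List A) → ℕ ₋ → Set a
    IsMax zs ⊥₋    = ∀ z → ¬ z ∈ zs
    IsMax zs [ ℓ ] = (∃ λ z → z ∈ zs × length z ≡ ℓ) × (∀ w → w ∈ zs → length w ≤ ℓ)

    isMax : ∀ zs → IsMax zs (max₋ (map ([_] ∘ length) zs))
    isMax [] z ()
    isMax (z ∷ zs) with max₋ (map ([_] ∘ length) zs) | isMax zs
    ... | ⊥₋ | none = (z , here refl , refl) ,
          λ { w (here refl) → ℕ.≤-refl ; w (there w∈) → ⊥-elim (none w w∈) }
    ... | [ ℓ ] | (v , v∈ , refl) , ub = attained ,
          λ { w (here refl) → ℕ.m≤m⊔n _ _ ; w (there w∈) → ℕ.≤-trans (ub w w∈) (ℕ.m≤n⊔m _ _) }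
      where
      attained : ∃ λ u → u ∈ z ∷ zs × length u ≡ length z ⊔ length v
      attained with ℕ.⊔-sel (length z) (length v)
      ... | inj₁ eq = z , here refl , sym eq
      ... | inj₂ eq = v , there v∈ , sym eq

    candidates : ℕ → ℕ → ℕ → List (List A)
    candidates i j k = filter (candidate? i j k) (subsequences (take i X))

    ∈-candidates⁺ : ∀ {i j k z} → Candidate i j k z → z ∈ candidates i j k
    ∈-candidates⁺ {i} {j} {k} c =
      ∈-filter⁺ (candidate? i j k) (∈-subsequences (Candidate.⊆X c)) c

    ∈-candidates⁻ : ∀ {i j k z} → z ∈ candidates i j k → Candidate i j k z
    ∈-candidates⁻ {i} {j} {k} z∈ =
      proj₂ (∈-filter⁻ (candidate? i j k) {xs = subsequences (take i X)} z∈)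

  f-Z : ∀ {i j k z} → Z i j k z → f i j k ≡ [ length z ]
  f-Z {i} {j} {k} {z} (c , longest) with f i j k | isMax (candidates i j k)
  ... | ⊥₋    | none = ⊥-elim (none z (∈-candidates⁺ c))
  ... | [ _ ] | (v , v∈ , refl) , ub =
        cong [_] (ℕ.≤-antisym (longest v (∈-candidates⁻ v∈)) (ub z (∈-candidates⁺ c)))

  f-∅ : ∀ {i j k} → ¬ ∃ (Z i j k) → f i j k ≡ ⊥₋
  f-∅ {i} {j} {k} empty with f i j k | isMax (candidates i j k)
  ... | ⊥₋    | _ = refl
  ... | [ _ ] | (v , v∈ , refl) , ub =
        ⊥-elim (empty (v , ∈-candidates⁻ v∈ , λ w c → ub w (∈-candidates⁺ c)))

{-# OPTIONS --safe #-}
-- A word z drives the Knuth–Morris–Pratt automaton of P to state σ z: appending x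
-- leads from t = σ z to σ (take t P ∷ʳ x), and z first meets P on reaching state r.
-- The recurrence follows by removing a common last character of a candidate.
--
-- A table F with boundary value 0 in every state maximises instead over common
-- subsequences w read from an arbitrary state, i.e. after an arbitrary word u.
-- If w ends in state k and k ≤ length w, then σ w = k, so w is a candidate.
-- Otherwise w is shorter than k, hence shorter than every member of Z i j k, so
-- the spurious values are harmless wherever Z i j k is inhabited.
module Submission where

open import Defs
open import Algebra.Definitions.RawMagma using (_,_)
open import Data.Empty using (⊥-elim)
open import Data.Fin.Base using (Fin; toℕ; fromℕ<)
open import Data.Fin.Properties using (toℕ-fromℕ<)
open import Data.List.Base
  using (List; []; _∷_; _∷ʳ_; _++_; length; lookup; map; filter; take; drop; upTo; initLast; _∷ʳ′_)
  renaming (tails to suffixes)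
open import Data.List.Extrema.Nat using (v≤max⁺; argmax-sel)
open import Data.List.Membership.Propositional using (_∈_)
open import Data.List.Membership.Propositional.Properties
  using (∈-map⁺; ∈-map⁻; ∈-++⁺ˡ; ∈-++⁺ʳ; ∈-filter⁺; ∈-filter⁻; ∈-upTo⁺; ∈-upTo⁻)
open import Data.List.Properties
  using (++-assoc; ++-identityʳ; ∷-injectiveʳ; ∷ʳ-injective; ∷ʳ-injectiveˡ; length-++;
         length-++-≤ʳ; length-take; take++drop≡id; take-suc; foldr-preservesᵇ)
open import Data.List.Relation.Binary.Infix.Heterogeneous as Infix using (Infix; MkView; _ⁱ++_; _++ⁱ_)
open import Data.List.Relation.Binary.Infix.Heterogeneous.Properties using (fromPointwise; length-mono)
open import Data.List.Relation.Binary.Pointwise as Pointwise using (Pointwise-≡⇒≡)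
open import Data.List.Relation.Binary.Prefix.Heterogeneous.Properties using (prefix?)
open import Data.List.Relation.Binary.Prefix.Propositional.Properties using (Prefix-as-∣ˡ; ∣ˡ-as-Prefix)
open import Data.List.Relation.Binary.Sublist.Propositional as Sublist
  using (_⊆_; []; _∷_; ⊆-trans; ⊆-refl; minimum)
open import Data.List.Relation.Binary.Sublist.Propositional.Properties using (++⁺; ++⁺ʳ)
import Data.List.Relation.Unary.All as All
import Data.List.Relation.Unary.All.Properties as All
open import Data.List.Relation.Unary.Any as Any using (here; there)
open import Data.Nat.Base using (ℕ; zero; suc; _≤_; _<_; z≤n; s≤s)
import Data.Nat.Properties as ℕ
open import Data.Product.Base using (∃; ∃₂; _×_; _,_; proj₁; proj₂)
open import Data.Sum.Base using (_⊎_; inj₁; inj₂)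
open import Data.Unit.Polymorphic using (⊤; tt)
open import Function.Base using (_∘_; _$_)
open import Relation.Binary.Definitions using (DecidableEquality)
open import Relation.Binary.PropositionalEquality
  using (_≡_; _≢_; refl; sym; trans; cong; subst; subst₂)
open import Relation.Binary.Construct.Add.Infimum.NonStrict _≤_
  using (_≤₋_; ⊥₋≤_; [_]; ≤₋-trans; ≤₋-reflexive-≡; ≤₋-antisym-≡)
open import Relation.Nullary using (¬_; yes; no)
open import Relation.Nullary.Construct.Add.Infimum using (_₋; ⊥₋; [_])

-- Order and maxima on lengths extended by minus infinity.

private
  variable
    v v′ w w′ : ℕ ₋

≤₋-refl : v ≤₋ v
≤₋-refl = ≤₋-reflexive-≡ ℕ.≤-reflexive refl

x≤x⊔₋y : ∀ v w → v ≤₋ v ⊔₋ w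
x≤x⊔₋y ⊥₋    w     = ⊥₋≤ _
x≤x⊔₋y [ x ] ⊥₋    = ≤₋-refl
x≤x⊔₋y [ x ] [ y ] = [ ℕ.m≤m⊔n x y ]

y≤x⊔₋y : ∀ v w → w ≤₋ v ⊔₋ w
y≤x⊔₋y ⊥₋    w     = ≤₋-refl
y≤x⊔₋y [ x ] ⊥₋    = ⊥₋≤ _
y≤x⊔₋y [ x ] [ y ] = [ ℕ.m≤n⊔m x y ]

-- The larger of two values is one of them, so `Q` need not be monotone. This serves both for upper
-- bounds and for attainment of a value by a word.
⊔₋-preserves : ∀ {p} (Q : ℕ ₋ → Set p) v w → Q v → Q w → Q (v ⊔₋ w)
⊔₋-preserves Q ⊥₋    w     p q = q
⊔₋-preserves Q [ x ] ⊥₋    p q = p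
⊔₋-preserves Q [ x ] [ y ] p q with ℕ.⊔-sel x y
... | inj₁ eq = subst (Q ∘ [_]) (sym eq) p
... | inj₂ eq = subst (Q ∘ [_]) (sym eq) q

⊔₋-mono : v ≤₋ v′ → w ≤₋ w′ → v ⊔₋ w ≤₋ v′ ⊔₋ w′
⊔₋-mono {v′ = v′} {w′ = w′} p q = ⊔₋-preserves (_≤₋ v′ ⊔₋ w′) _ _
  (≤₋-trans ℕ.≤-trans p (x≤x⊔₋y _ _)) (≤₋-trans ℕ.≤-trans q (y≤x⊔₋y v′ _))

1+₋-mono : v ≤₋ w → 1+₋ v ≤₋ 1+₋ w
1+₋-mono (⊥₋≤ _) = ⊥₋≤ _
1+₋-mono [ p ]   = [ s≤s p ]

max₋-preserves : ∀ {b p} {B : Set b} (Q : ℕ ₋ → Set p) (g : B → ℕ ₋) {xs : List B} →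
  Q ⊥₋ → (∀ {x} → x ∈ xs → Q (g x)) → Q (max₋ (map g xs))
max₋-preserves Q g q⊥ q = foldr-preservesᵇ {P = Q} (⊔₋-preserves Q _ _) q⊥ (All.map⁺ (All.tabulate q))

∈⇒≤max₋ : ∀ {vs} → v ∈ vs → v ≤₋ max₋ vs
∈⇒≤max₋ (here refl) = x≤x⊔₋y _ _
∈⇒≤max₋ (there v∈)  = ≤₋-trans ℕ.≤-trans (∈⇒≤max₋ v∈) (y≤x⊔₋y _ _)

-- Suffixes, substrings and subsequences of lists.

module _ {a} {A : Set a} where

  ∈-subsequences : ∀ {z xs : List A} → z ⊆ xs → z ∈ subsequences xs
  ∈-subsequences []                          = here refl
  ∈-subsequences {xs = x ∷ _} (.x Sublist.∷ʳ p) = ∈-++⁺ʳ (map (x ∷_) _) (∈-subsequences p)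
  ∈-subsequences (refl ∷ p)                  = ∈-++⁺ˡ (∈-map⁺ _ (∈-subsequences p))

  ∈-suffixes⁺ : ∀ s {u : List A} → u ∈ suffixes (s ++ u)
  ∈-suffixes⁺ []      {[]}    = here refl
  ∈-suffixes⁺ []      {_ ∷ _} = here refl
  ∈-suffixes⁺ (_ ∷ s)         = there (∈-suffixes⁺ s)

  ∈-suffixes⁻ : ∀ {S u : List A} → u ∈ suffixes S → ∃ λ s → S ≡ s ++ u
  ∈-suffixes⁻ {[]}    (here refl) = [] , refl
  ∈-suffixes⁻ {x ∷ S} (here refl) = [] , refl
  ∈-suffixes⁻ {x ∷ S} (there u∈) with s , refl ← ∈-suffixes⁻ u∈ = x ∷ s , refl

  take-length-++ : ∀ (u v : List A) → take (length u) (u ++ v) ≡ u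
  take-length-++ []      v = refl
  take-length-++ (x ∷ u) v = cong (x ∷_) (take-length-++ u v)

  length-∷ʳ : ∀ (z : List A) x → length (z ∷ʳ x) ≡ suc (length z)
  length-∷ʳ z x = trans (length-++ z) (ℕ.+-comm (length z) 1)

  -- Suffixes of one string are nested according to length: cancel common first characters until `s`
  -- is exhausted. If `s′` ran out first, `u` would be longer than `v`.
  shorter-suffix : ∀ s s′ {v u : List A} → s ++ v ≡ s′ ++ u → length u ≤ length v →
    ∃ λ t → v ≡ t ++ u
  shorter-suffix []      s′       eq   _  = s′ , eq
  shorter-suffix (x ∷ s) []       refl le =
    ⊥-elim (ℕ.<-irrefl refl (ℕ.≤-trans (s≤s (length-++-≤ʳ _ {s})) le))
  shorter-suffix (x ∷ s) (y ∷ s′) eq   le = shorter-suffix s s′ (∷-injectiveʳ eq) le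

  ∷ʳ-suffix⁻ : ∀ {z x} s (u : List A) → z ∷ʳ x ≡ s ++ u →
    u ≡ [] ⊎ ∃ λ u′ → u ≡ u′ ∷ʳ x × z ≡ s ++ u′
  ∷ʳ-suffix⁻ {z} s u eq with initLast u
  ... | []       = inj₁ refl
  ... | u′ ∷ʳ′ y with refl , refl ← ∷ʳ-injective z (s ++ u′) (trans eq (sym (++-assoc s u′ _)))
                 = inj₂ (u′ , refl , refl)

  infix-++ : ∀ s (u t : List A) → Infix _≡_ u (s ++ u ++ t)
  infix-++ s u t = Infix.fromView (MkView s (Pointwise.refl refl) t)

  infix-view : ∀ {u S : List A} → Infix _≡_ u S → ∃₂ λ s t → S ≡ s ++ u ++ t
  infix-view inf with MkView s eqs t ← Infix.toView inf
    with refl ← Pointwise-≡⇒≡ eqs = s , t , refl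

  -- Look at what follows the occurrence of `u`: either nothing does, or the remainder ends in `x`
  -- and the occurrence lies inside `z`.
  infix-∷ʳ⁻ : ∀ {u z : List A} {x} → Infix _≡_ u (z ∷ʳ x) →
    Infix _≡_ u z ⊎ ∃ λ s → z ∷ʳ x ≡ s ++ u
  infix-∷ʳ⁻ {u} {z} inf with s , t , eq ← infix-view inf
    with ∷ʳ-suffix⁻ {z} (s ++ u) t (trans eq (sym (++-assoc s u t)))
  ... | inj₁ refl = inj₂ (s , trans eq (cong (s ++_) (++-identityʳ u)))
  ... | inj₂ (t′ , refl , refl) =
        inj₁ (subst (Infix _≡_ u) (sym (++-assoc s u t′)) (infix-++ s u t′))

  ⊆-∷ʳ⁺ : ∀ {z ws : List A} {x} → z ⊆ ws → z ∷ʳ x ⊆ ws ∷ʳ x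
  ⊆-∷ʳ⁺ p = ++⁺ p ⊆-refl

  ⊆-∷ʳ⁻ : ∀ {z} ws {x : A} → z ⊆ ws ∷ʳ x → z ⊆ ws ⊎ ∃ λ z′ → z ≡ z′ ∷ʳ x × z′ ⊆ ws
  ⊆-∷ʳ⁻ []       (_ Sublist.∷ʳ p) = inj₁ p
  ⊆-∷ʳ⁻ []       (refl ∷ [])      = inj₂ ([] , refl , [])
  ⊆-∷ʳ⁻ (w ∷ ws) (.w Sublist.∷ʳ p) with ⊆-∷ʳ⁻ ws p
  ... | inj₁ q              = inj₁ (w Sublist.∷ʳ q)
  ... | inj₂ (z′ , refl , q) = inj₂ (z′ , refl , w Sublist.∷ʳ q)
  ⊆-∷ʳ⁻ (w ∷ ws) (refl ∷ p) with ⊆-∷ʳ⁻ ws p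
  ... | inj₁ q              = inj₁ (refl ∷ q)
  ... | inj₂ (z′ , refl , q) = inj₂ (w ∷ z′ , refl , refl ∷ q)

  ∷ʳ-⊆-∷ʳ⁻ : ∀ {z} ws {x : A} → z ∷ʳ x ⊆ ws ∷ʳ x → z ⊆ ws
  ∷ʳ-⊆-∷ʳ⁻ {z} ws {x} p with ⊆-∷ʳ⁻ ws p
  -- The final `x` of `ws ∷ʳ x` is avoided, so even `z ∷ʳ x` embeds in `ws`.
  ... | inj₁ q              = ⊆-trans (++⁺ʳ (x ∷ []) ⊆-refl) q
  ... | inj₂ (z′ , eq , q)  = subst (_⊆ ws) (sym (∷ʳ-injectiveˡ z z′ eq)) q

  take-⊆-take-suc : ∀ (xs : List A) (p : Fin (length xs)) → take (toℕ p) xs ⊆ take (suc (toℕ p)) xs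
  take-⊆-take-suc xs p = subst (take (toℕ p) xs ⊆_) (sym (take-suc xs p)) (++⁺ʳ _ ⊆-refl)

  ⊆[]⇒≡[] : ∀ {z : List A} → z ⊆ [] → z ≡ []
  ⊆[]⇒≡[] [] = refl

-- The step is phrased with `Fin` indices so that an instance of `Recurrence` applies to it
-- directly; the conclusion ranges over bounded natural numbers, which include the boundary index 0.
grid-induction : ∀ {p n m} (T : ℕ → ℕ → Set p) →
  (∀ i → i ≤ n → T i 0) → (∀ j → j ≤ m → T 0 j) →
  (∀ (i : Fin n) (j : Fin m) → let i-1 = toℕ i ; j-1 = toℕ j in
    T i-1 j-1 → T i-1 (suc j-1) → T (suc i-1) j-1 → T (suc i-1) (suc j-1)) →
  ∀ i j → i ≤ n → j ≤ m → T i j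
grid-induction T column row step i       zero    i≤n j≤m = column i i≤n
grid-induction T column row step zero    (suc j) i≤n j≤m = row (suc j) j≤m
grid-induction T column row step (suc i) (suc j) i<n j<m =
  subst₂ (λ i j → T i j → T i (suc j) → T (suc i) j → T (suc i) (suc j))
    (toℕ-fromℕ< i<n) (toℕ-fromℕ< j<m) (step (fromℕ< i<n) (fromℕ< j<m))
    (T-at i j (ℕ.<⇒≤ i<n) (ℕ.<⇒≤ j<m))
    (T-at i (suc j) (ℕ.<⇒≤ i<n) j<m)
    (T-at (suc i) j i<n (ℕ.<⇒≤ j<m))
  where T-at = grid-induction T column row step

module _ {a} {A : Set a} (_≟_ : DecidableEquality A) (X Y P : List A) where
  open ConstrainedLCS _≟_ X Y P

  private
    variable
      i j k t : ℕ
      x : A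
      z : List A

  -- The state function `σ`: longest borders and automaton transitions.

  σ-longest : ∀ s u v → u ++ v ≡ P → length u ≤ σ (s ++ u)
  σ-longest s u v eq = v≤max⁺ 0 _ $ inj₂ $ Any.map ℕ.≤-reflexive $ ∈-map⁺ length $
    ∈-filter⁺ (λ u → prefix? _≟_ u P) (∈-suffixes⁺ s) (∣ˡ-as-Prefix (v , eq))

  record LongestBorder (S : List A) : Set a where
    field
      before border after : List A
      suffix : S ≡ before ++ border
      prefix : border ++ after ≡ P
      size   : length border ≡ σ S

  longestBorder : ∀ S → LongestBorder S
  longestBorder S with argmax-sel (λ l → l) 0 (map length (filter (λ u → prefix? _≟_ u P) (suffixes S)))
  -- The maximum may be the default value 0 instead of a listed length; the empty border then
  -- attains it.
  ... | inj₁ eq = record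
        { border = [] ; suffix = sym (++-identityʳ S) ; prefix = refl ; size = sym eq }
  ... | inj₂ l∈ with u , u∈ , eq ← ∈-map⁻ length l∈
    with u∈S , u-prefix ← ∈-filter⁻ (λ u → prefix? _≟_ u P) {xs = suffixes S} u∈
    with s , suffix ← ∈-suffixes⁻ u∈S | v , prefix ← Prefix-as-∣ˡ u-prefix = record
        { border = u ; suffix = suffix ; prefix = prefix ; size = sym eq }

  module Border S = LongestBorder (longestBorder S)

  border≡take : ∀ S → Border.border S ≡ take (σ S) P
  border≡take S = trans (sym (take-length-++ border after))
    (subst (λ Q → take (length border) (border ++ after) ≡ take (σ S) Q) prefix
      (cong (λ l → take l (border ++ after)) size))
    where open Border S

  σ≤length : ∀ S → σ S ≤ length S
  σ≤length S = subst₂ _≤_ size (cong length (sym suffix)) (length-++-≤ʳ border {before})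
    where open Border S

  σ≤r : ∀ S → σ S ≤ r
  σ≤r S = subst₂ _≤_ size (trans (sym (length-++ border)) (cong length prefix))
    (ℕ.m≤m+n (length border) (length after))
    where open Border S

  σ-++ʳ : ∀ s S → σ S ≤ σ (s ++ S)
  σ-++ʳ s S = subst₂ _≤_ size (cong σ (trans (++-assoc s before border) (cong (s ++_) (sym suffix))))
    (σ-longest (s ++ before) border after prefix)
    where open Border S

  -- The longest border of `s ++ S` fits inside `S`, hence is a border of `S` as well, and the part
  -- `s` has no influence on the state.
  σ-suffix : ∀ s S → σ (s ++ S) ≤ length S → σ S ≡ σ (s ++ S)
  σ-suffix s S le = ℕ.≤-antisym (σ-++ʳ s S) σ≤
    where
    open Border (s ++ S)
    σ≤ : σ (s ++ S) ≤ σ S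
    σ≤ with t , eq ← shorter-suffix s before suffix (subst (_≤ length S) (sym size) le) =
      subst₂ _≤_ size (cong σ (sym eq)) (σ-longest t border after prefix)

  -- Deleting the last character of a nonempty border of `z ∷ʳ x` leaves a border of `z`.
  σ-∷ʳ≤ : ∀ z x → σ (z ∷ʳ x) ≤ suc (σ z)
  σ-∷ʳ≤ z x = subst (_≤ suc (σ z)) size (bound (∷ʳ-suffix⁻ before border suffix))
    where
    open Border (z ∷ʳ x)
    bound : (border ≡ [] ⊎ ∃ λ u → border ≡ u ∷ʳ x × z ≡ before ++ u) →
      length border ≤ suc (σ z)
    bound (inj₁ eq) = subst (λ u → length u ≤ suc (σ z)) (sym eq) z≤n
    bound (inj₂ (u , eq , z≡)) = subst₂ (λ u S → length u ≤ suc (σ S)) (sym eq) (sym z≡)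
      (subst (_≤ suc (σ (before ++ u))) (sym (length-∷ʳ u x))
        (s≤s (σ-longest before u (x ∷ after)
          (trans (sym (++-assoc u (x ∷ []) after)) (trans (cong (_++ after) (sym eq)) prefix)))))

  -- The new state depends on `z` only through its state. By `σ-∷ʳ≤` the new border is no longer
  -- than the old one followed by `x`, so `σ-suffix` discards everything before the old border.
  σ-∷ʳ : ∀ z x → σ (take (σ z) P ∷ʳ x) ≡ σ (z ∷ʳ x)
  σ-∷ʳ z x = subst (λ u → σ (u ∷ʳ x) ≡ σ (z ∷ʳ x)) (border≡take z)
    (trans (σ-suffix before (border ∷ʳ x) (subst₂ _≤_ (cong σ split) 1+σ (σ-∷ʳ≤ z x)))
           (cong σ (sym split)))
    where
    open Border z
    split : z ∷ʳ x ≡ before ++ border ∷ʳ x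
    split = trans (cong (_∷ʳ x) suffix) (++-assoc before border (x ∷ []))
    1+σ : suc (σ z) ≡ length (border ∷ʳ x)
    1+σ = trans (cong suc (sym size)) (sym (length-∷ʳ border x))

  -- In state `r` the longest border would be all of `P`, which would then occur at the end of `z`.
  excludes⇒σ<r : ¬ Infix _≡_ P z → σ z < r
  excludes⇒σ<r {z} ex = ℕ.≤∧≢⇒< (σ≤r z) λ σ≡r →
    let border≡P = trans (border≡take z) (trans (cong (λ l → take l P) σ≡r) take-r) in
    ex (subst (Infix _≡_ P) (sym (trans suffix (cong (before ++_) border≡P)))
         (before ++ⁱ fromPointwise (Pointwise.refl refl)))
    where
    open Border z
    take-r : take r P ≡ P
    take-r = trans (cong (take r) (sym (++-identityʳ P))) (take-length-++ P [])

  -- A first occurrence of `P` has to end at the new character, which makes `P` itself a border and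
  -- forces state `r`.
  excludes-∷ʳ : ¬ Infix _≡_ P z → σ (z ∷ʳ x) < r → ¬ Infix _≡_ P (z ∷ʳ x)
  excludes-∷ʳ ex σ<r inf with infix-∷ʳ⁻ inf
  ... | inj₁ P∈z      = ex P∈z
  ... | inj₂ (s , eq) = ℕ.<⇒≱ (subst (λ S → σ S < r) eq σ<r) (σ-longest s P [] (++-identityʳ P))

  -- The value `f` as a maximum over candidates, and its boundary values.

  f-preserves : ∀ {p} (Q : ℕ ₋ → Set p) → Q ⊥₋ → (∀ {z} → Candidate i j k z → Q [ length z ]) →
    Q (f i j k)
  f-preserves {i} {j} {k} Q q⊥ q = max₋-preserves Q ([_] ∘ length) q⊥
    (q ∘ proj₂ ∘ ∈-filter⁻ (candidate? i j k) {xs = subsequences (take i X)})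

  candidate≤f : Candidate i j k z → [ length z ] ≤₋ f i j k
  candidate≤f {i} {j} {k} c = ∈⇒≤max₋ (∈-map⁺ ([_] ∘ length)
    (∈-filter⁺ (candidate? i j k) (∈-subsequences (Candidate.⊆X c)) c))

  f-[] : (∀ {z} → Candidate i j k z → z ≡ []) → f i j k ≤₋ [ 0 ]
  f-[] only = f-preserves (_≤₋ [ 0 ]) (⊥₋≤ _) λ c → [ ℕ.≤-reflexive (cong length (only c)) ]

  f-column≤0 : ∀ i k → f i 0 k ≤₋ [ 0 ]
  f-column≤0 i k = f-[] {i} {0} {k} (⊆[]⇒≡[] ∘ Candidate.⊆Y)

  f-row≤0 : ∀ j k → f 0 j k ≤₋ [ 0 ]
  f-row≤0 j k = f-[] {0} {j} {k} (⊆[]⇒≡[] ∘ Candidate.⊆X)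

  f-boundary : f i j k ≤₋ [ 0 ] → ∃ (Z i j k) → f i j k ≡ [ 0 ]
  f-boundary le (z , zZ) = ≤₋-antisym-≡ ℕ.≤-antisym le (≤₋-trans ℕ.≤-trans [ z≤n ] (candidate≤f (proj₁ zZ)))

  -- Run [] i j k z is Candidate i j k z.
  record Run (u : List A) (i j k : ℕ) (w : List A) : Set a where
    constructor run
    field
      ⊆X       : w ⊆ take i X
      ⊆Y       : w ⊆ take j Y
      excludes : ¬ Infix _≡_ P (u ++ w)
      state    : σ (u ++ w) ≡ k

  -- Appending and removing a common last character.

  predecessors : A → ℕ → List ℕ
  predecessors x k = filter (λ t → σ (take t P ∷ʳ x) ℕ.≟ k) (upTo r)

  predecessor : t ∈ predecessors x k → t < r × σ (take t P ∷ʳ x) ≡ k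
  predecessor {k = k} t∈ with t∈r , eq ← ∈-filter⁻ (λ t → σ (take t P ∷ʳ _) ℕ.≟ k) {xs = upTo r} t∈ =
    ∈-upTo⁻ t∈r , eq

  module _ (p : Fin n) (q : Fin m) where
    private
      i-1 = toℕ p
      j-1 = toℕ q
      xᵢ = lookup X p
      yⱼ = lookup Y q

    -- By `σ-∷ʳ` the extended word reaches state `k`, and since `k < r` no occurrence of `P` is
    -- completed. Allowing an arbitrary `u` covers candidates, with `u` empty, as well as the runs
    -- behind the entries of a table.
    run-append : xᵢ ≡ yⱼ → k < r → t ∈ predecessors xᵢ k → ∀ {u w} →
      Run u i-1 j-1 t w → Run u (suc i-1) (suc j-1) k (w ∷ʳ xᵢ)
    run-append {k} eq k<r t∈ {u} {w} (run w⊆X w⊆Y ex refl) = run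
      (subst (w ∷ʳ xᵢ ⊆_) (sym (take-suc X p)) (⊆-∷ʳ⁺ w⊆X))
      (subst (w ∷ʳ xᵢ ⊆_) (sym (trans (take-suc Y q) (cong (take j-1 Y ∷ʳ_) (sym eq)))) (⊆-∷ʳ⁺ w⊆Y))
      (subst (λ S → ¬ Infix _≡_ P S) assoc (excludes-∷ʳ ex (subst (_< r) (sym state) k<r)))
      (trans (cong σ (sym assoc)) state)
      where
      assoc = ++-assoc u w (xᵢ ∷ [])
      state : σ ((u ++ w) ∷ʳ xᵢ) ≡ k
      state = trans (sym (σ-∷ʳ (u ++ w) xᵢ)) (proj₂ (predecessor t∈))

    candidate-append : xᵢ ≡ yⱼ → k < r → t ∈ predecessors xᵢ k →
      Candidate i-1 j-1 t z → Candidate (suc i-1) (suc j-1) k (z ∷ʳ xᵢ)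
    candidate-append eq k<r t∈ (candidate z⊆X z⊆Y ex st)
      with run z⊆X′ z⊆Y′ ex′ st′ ← run-append eq k<r t∈ {u = []} (run z⊆X z⊆Y ex st) =
      candidate z⊆X′ z⊆Y′ ex′ st′

    -- If both embeddings used the last position, the last character of `z` would equal both `xᵢ`
    -- and `yⱼ`.
    candidate-drop : xᵢ ≢ yⱼ → Candidate (suc i-1) (suc j-1) k z →
      Candidate i-1 (suc j-1) k z ⊎ Candidate (suc i-1) j-1 k z
    candidate-drop {z = z} neq (candidate z⊆X z⊆Y ex st)
      with ⊆-∷ʳ⁻ _ (subst (z ⊆_) (take-suc X p) z⊆X) | ⊆-∷ʳ⁻ _ (subst (z ⊆_) (take-suc Y q) z⊆Y)
    ... | inj₁ z⊆X′ | _ = inj₁ (candidate z⊆X′ z⊆Y ex st)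
    ... | inj₂ _    | inj₁ z⊆Y′ = inj₂ (candidate z⊆X z⊆Y′ ex st)
    ... | inj₂ (z′ , refl , _) | inj₂ (z″ , eq , _) = ⊥-elim (neq (proj₂ (∷ʳ-injective z′ z″ eq)))

    candidate-∷ʳ⁻ : xᵢ ≡ yⱼ → Candidate (suc i-1) (suc j-1) k (z ∷ʳ xᵢ) →
      σ z ∈ predecessors xᵢ k × Candidate i-1 j-1 (σ z) z
    candidate-∷ʳ⁻ {k} {z} eq (candidate z⊆X z⊆Y ex st) =
      ∈-filter⁺ (λ t → σ (take t P ∷ʳ xᵢ) ℕ.≟ k) (∈-upTo⁺ (excludes⇒σ<r ex′)) (trans (σ-∷ʳ z xᵢ) st) ,
      candidate (∷ʳ-⊆-∷ʳ⁻ _ (subst (z ∷ʳ xᵢ ⊆_) (take-suc X p) z⊆X))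
                (∷ʳ-⊆-∷ʳ⁻ _ (subst (z ∷ʳ xᵢ ⊆_) (trans (take-suc Y q) (cong (take j-1 Y ∷ʳ_) (sym eq))) z⊆Y))
                ex′ refl
      where
      ex′ : ¬ Infix _≡_ P z
      ex′ inf = ex (inf ⁱ++ (xᵢ ∷ []))

    candidate-remove : xᵢ ≡ yⱼ → Candidate (suc i-1) (suc j-1) k z →
      Candidate i-1 j-1 k z ⊎
      ∃ λ z′ → z ≡ z′ ∷ʳ xᵢ × σ z′ ∈ predecessors xᵢ k × Candidate i-1 j-1 (σ z′) z′
    candidate-remove {z = z} eq c@(candidate z⊆X z⊆Y ex st)
      with ⊆-∷ʳ⁻ _ (subst (z ⊆_) (take-suc X p) z⊆X) | ⊆-∷ʳ⁻ _ (subst (z ⊆_) (take-suc Y q) z⊆Y)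
    ... | inj₁ z⊆X′ | inj₁ z⊆Y′ = inj₁ (candidate z⊆X′ z⊆Y′ ex st)
    ... | inj₂ (z′ , refl , _) | _ = inj₂ (z′ , refl , candidate-∷ʳ⁻ eq c)
    -- Only the embedding into `Y` uses its last position, but `z` still ends in `yⱼ`, which is
    -- `xᵢ`.
    ... | inj₁ _ | inj₂ (z′ , z≡ , _) with refl ← trans z≡ (cong (z′ ∷ʳ_) (sym eq)) =
          inj₂ (z′ , refl , candidate-∷ʳ⁻ eq c)

  -- The recurrence for `f`, by two inequalities in each case.

  f-mono : ∀ {i i′ j j′} → take i X ⊆ take i′ X → take j Y ⊆ take j′ Y → f i j k ≤₋ f i′ j′ k
  f-mono {k} {i′ = i′} {j′ = j′} p q = f-preserves (_≤₋ f i′ j′ k) (⊥₋≤ _) λ (candidate z⊆X z⊆Y ex st) →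
    candidate≤f (candidate (⊆-trans z⊆X p) (⊆-trans z⊆Y q) ex st)

  f-recurrence : Recurrence f
  f-recurrence p q k k<r = unequal , equal
    where
    i-1 = toℕ p
    j-1 = toℕ q
    xᵢ = lookup X p
    yⱼ = lookup Y q
    X⊆ = take-⊆-take-suc X p
    Y⊆ = take-⊆-take-suc Y q

    new = f (suc i-1) (suc j-1) k

    unequal : xᵢ ≢ yⱼ → new ≡ f i-1 (suc j-1) k ⊔₋ f (suc i-1) j-1 k
    unequal neq = ≤₋-antisym-≡ ℕ.≤-antisym
      (f-preserves (_≤₋ up ⊔₋ left) (⊥₋≤ _) (bound ∘ candidate-drop p q neq))
      (⊔₋-preserves (_≤₋ new) up left
        (f-mono {i′ = suc i-1} {j = suc j-1} X⊆ ⊆-refl)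
        (f-mono {i = suc i-1} {j′ = suc j-1} ⊆-refl Y⊆))
      where
      up   = f i-1 (suc j-1) k
      left = f (suc i-1) j-1 k
      bound : ∀ {z} → Candidate i-1 (suc j-1) k z ⊎ Candidate (suc i-1) j-1 k z →
        [ length z ] ≤₋ up ⊔₋ left
      bound (inj₁ c) = ≤₋-trans ℕ.≤-trans (candidate≤f c) (x≤x⊔₋y up left)
      bound (inj₂ c) = ≤₋-trans ℕ.≤-trans (candidate≤f c) (y≤x⊔₋y up left)

    equal : xᵢ ≡ yⱼ →
      new ≡ f i-1 j-1 k ⊔₋ 1+₋ max₋ (map (f i-1 j-1) (predecessors xᵢ k))
    equal eq = ≤₋-antisym-≡ ℕ.≤-antisym
      (f-preserves (_≤₋ diagonal ⊔₋ 1+₋ best) (⊥₋≤ _) (bound ∘ candidate-remove p q eq))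
      (⊔₋-preserves (_≤₋ new) diagonal (1+₋ best)
        (f-mono {i′ = suc i-1} {j′ = suc j-1} X⊆ Y⊆)
        -- Each value in the inner maximum is `⊥₋` or the length of a candidate in a predecessor
        -- state; appending `xᵢ` turns that candidate into one counted by `new`.
        (max₋-preserves (λ v → 1+₋ v ≤₋ new) (f i-1 j-1) (⊥₋≤ _) λ t∈ →
          f-preserves (λ v → 1+₋ v ≤₋ new) (⊥₋≤ _) λ {z} c →
            subst (λ l → [ l ] ≤₋ new) (length-∷ʳ z xᵢ)
              (candidate≤f (candidate-append p q eq k<r t∈ c))))
      where
      diagonal = f i-1 j-1 k
      best     = max₋ (map (f i-1 j-1) (predecessors xᵢ k))
      bound : ∀ {z} → (Candidate i-1 j-1 k z ⊎
        ∃ λ z′ → z ≡ z′ ∷ʳ xᵢ × σ z′ ∈ predecessors xᵢ k × Candidate i-1 j-1 (σ z′) z′) →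
        [ length z ] ≤₋ diagonal ⊔₋ 1+₋ best
      bound (inj₁ c) = ≤₋-trans ℕ.≤-trans (candidate≤f c) (x≤x⊔₋y diagonal _)
      bound (inj₂ (z′ , refl , t∈ , c)) =
        subst (λ l → [ l ] ≤₋ diagonal ⊔₋ 1+₋ best) (sym (length-∷ʳ z′ xᵢ))
          (≤₋-trans ℕ.≤-trans
            (1+₋-mono (≤₋-trans ℕ.≤-trans (candidate≤f c) (∈⇒≤max₋ (∈-map⁺ (f i-1 j-1) t∈))))
            (y≤x⊔₋y diagonal _))

  -- Tables with boundary value 0.

  -- This replaces an upper bound on table entries: a finite entry is the length of an actual run,
  -- started after some word `u`.
  Reached : ℕ → ℕ → ℕ → ℕ ₋ → Set a
  Reached i j k ⊥₋    = ⊤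
  Reached i j k [ ℓ ] = ∃₂ λ u w → Run u i j k w × length w ≡ ℓ

  reached-mono : ∀ {i i′ j j′} → take i X ⊆ take i′ X → take j Y ⊆ take j′ Y →
    ∀ v → Reached i j k v → Reached i′ j′ k v
  reached-mono p q ⊥₋    _ = tt
  reached-mono p q [ ℓ ] (u , w , run w⊆X w⊆Y ex st , size) =
    u , w , run (⊆-trans w⊆X p) (⊆-trans w⊆Y q) ex st , size

  reached-append : ∀ (p : Fin n) (q : Fin m) → lookup X p ≡ lookup Y q → k < r →
    t ∈ predecessors (lookup X p) k → ∀ v →
    Reached (toℕ p) (toℕ q) t v → Reached (suc (toℕ p)) (suc (toℕ q)) k (1+₋ v)
  reached-append p q eq k<r t∈ ⊥₋    _ = tt
  reached-append p q eq k<r t∈ [ ℓ ] (u , w , ρ , size) =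
    u , w ∷ʳ lookup X p , run-append p q eq k<r t∈ ρ , trans (length-∷ʳ w _) (cong suc size)

  reached-0 : k < r → Reached i j k [ 0 ]
  -- The prefix of `P` of length `k` puts the automaton into state `k` and is too short to contain
  -- `P`; the run after it is empty.
  reached-0 {k} k<r = take k P , [] , run (minimum _) (minimum _) excl state , refl
    where
    length-u : length (take k P ++ []) ≡ k
    length-u = trans (cong length (++-identityʳ (take k P)))
      (trans (length-take k P) (ℕ.m≤n⇒m⊓n≡m (ℕ.<⇒≤ k<r)))
    excl : ¬ Infix _≡_ P (take k P ++ [])
    excl inf = ℕ.<⇒≱ k<r (subst (r ≤_) length-u (length-mono inf))
    state : σ (take k P ++ []) ≡ k
    state = ℕ.≤-antisym (subst (σ (take k P ++ []) ≤_) length-u (σ≤length (take k P ++ [])))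
      (subst (_≤ σ (take k P ++ [])) length-u
        (σ-longest [] (take k P ++ []) (drop k P)
          (trans (cong (_++ drop k P) (++-identityʳ (take k P))) (take++drop≡id k P))))

  module _ (F : ℕ → ℕ → ℕ → ℕ ₋) (recurrence : Recurrence F) (boundary : Boundary F) where

    private
      column : i ≤ n → k < r → F i 0 k ≡ [ 0 ]
      column i≤n k<r = proj₁ boundary _ _ i≤n (ℕ.<⇒≤ k<r)

      row : j ≤ m → k < r → F 0 j k ≡ [ 0 ]
      row j≤m k<r = proj₂ boundary _ _ j≤m (ℕ.<⇒≤ k<r)

    -- Both tables obey the same recurrence, which is monotone in the earlier entries, and on the
    -- boundary `f` is at most 0.
    f≤F : ∀ i j → i ≤ n → j ≤ m → ∀ k → k < r → f i j k ≤₋ F i j k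
    f≤F = grid-induction (λ i j → ∀ k → k < r → f i j k ≤₋ F i j k)
      (λ i i≤n k k<r → subst (f i 0 k ≤₋_) (sym (column i≤n k<r)) (f-column≤0 i k))
      (λ j j≤m k k<r → subst (f 0 j k ≤₋_) (sym (row j≤m k<r)) (f-row≤0 j k))
      step
      where
      step : ∀ (p : Fin n) (q : Fin m) → let i-1 = toℕ p ; j-1 = toℕ q in
        (∀ k → k < r → f i-1 j-1 k ≤₋ F i-1 j-1 k) →
        (∀ k → k < r → f i-1 (suc j-1) k ≤₋ F i-1 (suc j-1) k) →
        (∀ k → k < r → f (suc i-1) j-1 k ≤₋ F (suc i-1) j-1 k) →
        ∀ k → k < r → f (suc i-1) (suc j-1) k ≤₋ F (suc i-1) (suc j-1) k
      step p q diagonal up left k k<r with lookup X p ≟ lookup Y q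
      ... | no neq = subst₂ _≤₋_
            (sym (proj₁ (f-recurrence p q k k<r) neq)) (sym (proj₁ (recurrence p q k k<r) neq))
            (⊔₋-mono (up k k<r) (left k k<r))
      ... | yes eq = subst₂ _≤₋_
            (sym (proj₂ (f-recurrence p q k k<r) eq)) (sym (proj₂ (recurrence p q k k<r) eq))
            (⊔₋-mono (diagonal k k<r) (1+₋-mono
              (max₋-preserves (_≤₋ max₋ (map (F (toℕ p) (toℕ q)) (predecessors (lookup X p) k)))
                (f (toℕ p) (toℕ q)) (⊥₋≤ _) λ t∈ → ≤₋-trans ℕ.≤-trans
                (diagonal _ (proj₁ (predecessor t∈)))
                (∈⇒≤max₋ (∈-map⁺ (F (toℕ p) (toℕ q)) t∈)))))

    -- Each maximum in the recurrence selects one of its arguments, whose run is either kept or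
    -- extended by the common character.
    F-reached : ∀ i j → i ≤ n → j ≤ m → ∀ k → k < r → Reached i j k (F i j k)
    F-reached = grid-induction (λ i j → ∀ k → k < r → Reached i j k (F i j k))
      (λ i i≤n k k<r → subst (Reached i 0 k) (sym (column i≤n k<r)) (reached-0 k<r))
      (λ j j≤m k k<r → subst (Reached 0 j k) (sym (row j≤m k<r)) (reached-0 k<r))
      step
      where
      step : ∀ (p : Fin n) (q : Fin m) → let i-1 = toℕ p ; j-1 = toℕ q in
        (∀ k → k < r → Reached i-1 j-1 k (F i-1 j-1 k)) →
        (∀ k → k < r → Reached i-1 (suc j-1) k (F i-1 (suc j-1) k)) →
        (∀ k → k < r → Reached (suc i-1) j-1 k (F (suc i-1) j-1 k)) →
        ∀ k → k < r → Reached (suc i-1) (suc j-1) k (F (suc i-1) (suc j-1) k)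
      step p q diagonal up left k k<r with lookup X p ≟ lookup Y q
      ... | no neq = subst Target (sym (proj₁ (recurrence p q k k<r) neq))
            (⊔₋-preserves Target _ _
              (reached-mono (take-⊆-take-suc X p) ⊆-refl _ (up k k<r))
              (reached-mono ⊆-refl (take-⊆-take-suc Y q) _ (left k k<r)))
        where Target = Reached (suc (toℕ p)) (suc (toℕ q)) k
      ... | yes eq = subst Target (sym (proj₂ (recurrence p q k k<r) eq))
            (⊔₋-preserves Target _ _
              (reached-mono (take-⊆-take-suc X p) (take-⊆-take-suc Y q) _ (diagonal k k<r))
              (max₋-preserves (Target ∘ 1+₋_) (F (toℕ p) (toℕ q)) tt λ t∈ →
                reached-append p q eq k<r t∈ _ (diagonal _ (proj₁ (predecessor t∈)))))
        where Target = Reached (suc (toℕ p)) (suc (toℕ q)) k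

  run-long : ∀ {u w} → Run u i j k w → k ≤ length w → Candidate i j k w
  run-long {u = u} {w} (run w⊆X w⊆Y ex refl) k≤ =
    candidate w⊆X w⊆Y (ex ∘ (u ++ⁱ_)) (σ-suffix u w k≤)

  -- As `k = σ z` is at most the length of `z`, the run `w` has length at least `k`. By `run-long`
  -- it is a candidate, and so no longer than `z`.
  reached-unique : Z i j k z → Reached i j k v → [ length z ] ≤₋ v → v ≡ [ length z ]
  reached-unique {z = z} (candidate _ _ _ refl , longest) (u , w , ρ , refl) [ z≤w ] =
    cong [_] (ℕ.≤-antisym (longest w (run-long ρ (ℕ.≤-trans (σ≤length z) z≤w))) z≤w)

  F≡f : ∀ F → Recurrence F → Boundary F →
    ∀ i j k → i ≤ n → j ≤ m → k < r → ∃ (Z i j k) → F i j k ≡ f i j k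
  F≡f F recurrence boundary i j k i≤n j≤m k<r (z , zZ) =
    trans (reached-unique zZ (F-reached F recurrence boundary i j i≤n j≤m k k<r)
            (subst (_≤₋ F i j k) (f-Z zZ) (f≤F F recurrence boundary i j i≤n j≤m k k<r)))
          (sym (f-Z zZ))

theorem2 : ∀ {a} {A : Set a} (_≟_ : DecidableEquality A) (X Y P : List A) →
    let open ConstrainedLCS _≟_ X Y P in
    Recurrence f
    × (∀ i k → i ≤ n → k ≤ r → ∃ (Z i 0 k) → f i 0 k ≡ [ 0 ])
    × (∀ j k → j ≤ m → k ≤ r → ∃ (Z 0 j k) → f 0 j k ≡ [ 0 ])
    × (∀ (F : ℕ → ℕ → ℕ → ℕ ₋) → Recurrence F → Boundary F →
    ∀ i j k → i ≤ n → j ≤ m → k < r → ∃ (Z i j k) → F i j k ≡ f i j k)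
theorem2 _≟_ X Y P =
  f-recurrence _≟_ X Y P ,
  (λ i k _ _ → f-boundary _≟_ X Y P (f-column≤0 _≟_ X Y P i k)) ,
  (λ j k _ _ → f-boundary _≟_ X Y P (f-row≤0 _≟_ X Y P j k)) ,
  F≡f _≟_ X Y P
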